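{- Let $X$ be a positive integer and let $$b=\frac{ -1+\sqrt{4X+1}}{2}.$$ Let $S(X)=\left\{m : m=\left\lfloor \frac{X}{n}\right\rfloor \text{ for some positive integer } n\le X\right\}$. Then $$|S(X)|=\lfloor b\rfloor+\left\lfloor\frac{X}{\lfloor b+1\rfloor}\right\rfloor.$$
   Context: The variables $m$ and $n$ range over positive integers. For a real number $y$, $\lfloor y\rfloor$ denotes the greatest integer not exceeding $y$. $|S(X)|$ denotes the cardinality of the set $S(X)$ (distinct values are counted once). -}

module Defs where

open import Data.Nat.Base as ℕ using (ℕ)
open import Data.Integer.Base as ℤ using (ℤ; +_)
import Data.Integer.Properties as ℤ
open import Data.List.Base using (List; length)
open import Data.List.Membership.Propositional using (_∈_)
open import Data.List.Relation.Unary.Unique.Propositional using (Unique)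
open import Data.Product.Base using (∃; ∃-syntax; _×_; _,_; proj₁; proj₂)
open import Data.Rational.Base
open import Data.Rational.Properties
open import Data.Rational.Solver using (module +-*-Solver)
open import Data.Sum.Base using (_⊎_; inj₁; inj₂)
open import Function.Bundles using (_⇔_)
open import Relation.Binary.PropositionalEquality
open import Relation.Nullary using (¬_; yes; no; contradiction)

-- Dedekind reals: two-sided, rounded, located cuts of ℚ.

record ℝ : Set₁ where
  field
    Lower Upper     : ℚ → Set
    lower-inhabited : ∃ Lower
    upper-inhabited : ∃ Upper
    lower-closed    : ∀ {p q} → p < q → Lower q → Lower p
    upper-closed    : ∀ {p q} → p < q → Upper p → Upper q
    lower-open      : ∀ {q} → Lower q → ∃[ r ] q < r × Lower r
    upper-open      : ∀ {q} → Upper q → ∃[ r ] r < q × Upper r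
    disjoint        : ∀ {q} → Lower q → ¬ Upper q
    located         : ∀ {p q} → p < q → Lower p ⊎ Upper q

open ℝ

infix 4 _≤ᴿ_

_≤ᴿ_ : ℝ → ℝ → Set
x ≤ᴿ y = ∀ {q} → Lower x q → Lower y q

fromℚ : ℚ → ℝ
fromℚ a = record
  { Lower           = _< a
  ; Upper           = a <_
  ; lower-inhabited = a - 1ℚ , below
  ; upper-inhabited = a + 1ℚ , above
  ; lower-closed    = <-trans
  ; upper-closed    = λ p<q a<p → <-trans a<p p<q
  ; lower-open      = λ q<a → let r , q<r , r<a = <-dense q<a in r , q<r , r<a
  ; upper-open      = λ a<q → let r , a<r , r<q = <-dense a<q in r , r<q , a<r
  ; disjoint        = <-asym
  ; located         = split
  }
  where
  below : a - 1ℚ < a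
  below = subst (a - 1ℚ <_) (+-identityʳ a) (+-monoʳ-< a (negative⁻¹ (- 1ℚ)))

  above : a < a + 1ℚ
  above = subst (_< a + 1ℚ) (+-identityʳ a) (+-monoʳ-< a (positive⁻¹ 1ℚ))

  split : ∀ {p q} → p < q → p < a ⊎ a < q
  split {p} p<q with p <? a
  ... | yes p<a = inj₁ p<a
  ... | no  p≮a = inj₂ (≤-<-trans (≮⇒≥ p≮a) p<q)

fromℤ : ℤ → ℝ
fromℤ k = fromℚ (k / 1)

fromℕ : ℕ → ℝ
fromℕ n = fromℤ (+ n)

private

  sub-add : ∀ p a → (p - a) + a ≡ p
  sub-add = solve 2 (λ p a → (p :- a) :+ a := p) refl
    where open +-*-Solver

  add-sub : ∀ p a → (p + a) - a ≡ p
  add-sub = solve 2 (λ p a → (p :+ a) :- a := p) refl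
    where open +-*-Solver

infixl 6 _+ᴿ_
infixl 7 _/ᴿ_

-- Translation of a real by a rational: q < x + a iff q - a < x.

_+ᴿ_ : ℝ → ℚ → ℝ
x +ᴿ a = record
  { Lower           = λ q → Lower x (q - a)
  ; Upper           = λ q → Upper x (q - a)
  ; lower-inhabited = let p , l = lower-inhabited x in
                      p + a , subst (Lower x) (sym (add-sub p a)) l
  ; upper-inhabited = let p , u = upper-inhabited x in
                      p + a , subst (Upper x) (sym (add-sub p a)) u
  ; lower-closed    = λ p<q → lower-closed x (shift p<q)
  ; upper-closed    = λ p<q → upper-closed x (shift p<q)
  ; lower-open      = λ {q} l → let r , q<r , l′ = lower-open x l in
                      r + a , subst (_< r + a) (sub-add q a) (+-monoˡ-< a q<r)
                            , subst (Lower x) (sym (add-sub r a)) l′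
  ; upper-open      = λ {q} u → let r , r<q , u′ = upper-open x u in
                      r + a , subst (r + a <_) (sub-add q a) (+-monoˡ-< a r<q)
                            , subst (Upper x) (sym (add-sub r a)) u′
  ; disjoint        = disjoint x
  ; located         = λ p<q → located x (shift p<q)
  }
  where
  shift : ∀ {p q} → p < q → p - a < q - a
  shift = +-monoˡ-< (- a)

-- Division of a real by a positive rational: q < x / a iff q * a < x.

_/ᴿ_ : ℝ → (a : ℚ) → .{{Positive a}} → ℝ
x /ᴿ a = record
  { Lower           = λ q → Lower x (q * a)
  ; Upper           = λ q → Upper x (q * a)
  ; lower-inhabited = let p , l = lower-inhabited x in
                      p * a⁻¹ , subst (Lower x) (sym (cancel p)) l
  ; upper-inhabited = let p , u = upper-inhabited x in
                      p * a⁻¹ , subst (Upper x) (sym (cancel p)) u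
  ; lower-closed    = λ p<q → lower-closed x (scale p<q)
  ; upper-closed    = λ p<q → upper-closed x (scale p<q)
  ; lower-open      = λ {q} l → let r , q<r , l′ = lower-open x l in
                      r * a⁻¹ , unscale (subst (q * a <_) (sym (cancel r)) q<r)
                              , subst (Lower x) (sym (cancel r)) l′
  ; upper-open      = λ {q} u → let r , r<q , u′ = upper-open x u in
                      r * a⁻¹ , unscale (subst (_< q * a) (sym (cancel r)) r<q)
                              , subst (Upper x) (sym (cancel r)) u′
  ; disjoint        = disjoint x
  ; located         = λ p<q → located x (scale p<q)
  }
  where
  instance
    _ = pos⇒nonZero a
    _ = pos⇒nonNeg a

  a⁻¹ : ℚ
  a⁻¹ = 1/ a

  cancel : ∀ p → p * a⁻¹ * a ≡ p
  cancel p = trans (*-assoc p a⁻¹ a)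
                   (trans (cong (p *_) (*-inverseˡ a)) (*-identityʳ p))

  scale : ∀ {p q} → p < q → p * a < q * a
  scale = *-monoˡ-<-pos a

  unscale : ∀ {p q} → p * a < q * a → p < q
  unscale = *-cancelʳ-<-nonNeg a

private

  +-pos : ∀ {p q} → 0ℚ < p → 0ℚ < q → 0ℚ < p + q
  +-pos = +-mono-<

  *-pos : ∀ {p q} → 0ℚ < p → 0ℚ < q → 0ℚ < p * q
  *-pos {p} {q} 0<p 0<q =
    subst (_< p * q) (*-zeroʳ p) (*-monoʳ-<-pos p {{positive 0<p}} 0<q)

  diff-pos : ∀ {p q} → p < q → 0ℚ < q - p
  diff-pos {p} {q} p<q = subst (_< q - p) (+-inverseʳ p) (+-monoˡ-< (- p) p<q)

  <-of-diff : ∀ {p q d} → 0ℚ < d → p + d ≡ q → p < q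
  <-of-diff {p} {q} {d} 0<d eq = subst₂ _<_ (+-identityʳ p) eq (+-monoʳ-< p 0<d)

  square-< : ∀ {p q} → 0ℚ ≤ p → p < q → p * p < q * q
  square-< {p} {q} 0≤p p<q = ≤-<-trans
    (*-monoˡ-≤-nonNeg p {{nonNegative 0≤p}} (<⇒≤ p<q))
    (*-monoˡ-<-pos q {{positive (≤-<-trans 0≤p p<q)}} p<q)

  -- δ = e / w
  quotient : ∀ e w → 0ℚ < e → 0ℚ < w → ∃[ δ ] 0ℚ < δ × δ * w ≡ e
  quotient e w 0<e 0<w = e * 1/ w
    , *-pos 0<e (positive⁻¹ _ {{1/pos⇒pos w}})
    , trans (*-assoc e (1/ w) w)
            (trans (cong (e *_) (*-inverseˡ w)) (*-identityʳ e))
    where instance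
      w-pos = positive 0<w
      _     = pos⇒nonZero w

  -- r = q + δ with e = t - q² and δ = e / (2q + 1 + e)
  square-open-below : ∀ {q t} → 0ℚ ≤ q → q * q < t →
                      ∃[ r ] q < r × r * r < t
  square-open-below {q} {t} 0≤q qq<t = q + δ , <-of-diff 0<δ refl , below
    where
    e w : ℚ
    e = t - q * q
    w = q + q + 1ℚ + e
    0<e : 0ℚ < e
    0<e = diff-pos qq<t
    0≤q+q : 0ℚ ≤ q + q
    0≤q+q = +-mono-≤ 0≤q 0≤q
    0<w : 0ℚ < w
    0<w = +-pos (+-mono-≤-< 0≤q+q (positive⁻¹ 1ℚ)) 0<e
    step = quotient e w 0<e 0<w
    δ : ℚ
    δ = proj₁ step
    0<δ : 0ℚ < δ
    0<δ = proj₁ (proj₂ step)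
    δw≡e : δ * w ≡ e
    δw≡e = proj₂ (proj₂ step)
    e<w : e < w
    e<w = subst (_< w) (+-identityˡ e)
            (+-monoˡ-< e (+-mono-≤-< 0≤q+q (positive⁻¹ 1ℚ)))
    δ<1 : δ < 1ℚ
    δ<1 = *-cancelʳ-<-nonNeg w {{nonNegative (<⇒≤ 0<w)}}
            (subst₂ _<_ (sym δw≡e) (sym (*-identityˡ w)) e<w)
    below : (q + δ) * (q + δ) < t
    below = <-of-diff (*-pos 0<δ (+-pos (diff-pos δ<1) 0<e)) (trans
      (solve 3 (λ q δ e →
          (q :+ δ) :* (q :+ δ) :+ δ :* ((con 1ℚ :- δ) :+ e)
          := q :* q :+ δ :* (q :+ q :+ con 1ℚ :+ e)) refl q δ e)
      (trans (cong (λ z → q * q + z) δw≡e)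
        (solve 2 (λ s t → s :+ (t :- s) := t) refl (q * q) t)))
      where open +-*-Solver

  -- r = q - δ with e = q² - t and δ = e q / (2q² + e)
  square-open-above : ∀ {q t} → 0ℚ < q → t < q * q →
                      ∃[ r ] r < q × 0ℚ < r × t < r * r
  square-open-above {q} {t} 0<q t<qq =
    q - δ , <-of-diff 0<δ (sub-add q δ) , diff-pos δ<q , above
    where
    open +-*-Solver
    e w : ℚ
    e = q * q - t
    w = q * q + q * q + e
    0<e : 0ℚ < e
    0<e = diff-pos t<qq
    0<qq : 0ℚ < q * q
    0<qq = *-pos 0<q 0<q
    0<w : 0ℚ < w
    0<w = +-pos (+-pos 0<qq 0<qq) 0<e
    instance
      w-nonNeg = nonNegative (<⇒≤ 0<w)
    step = quotient (e * q) w (*-pos 0<e 0<q) 0<w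
    δ : ℚ
    δ = proj₁ step
    0<δ : 0ℚ < δ
    0<δ = proj₁ (proj₂ step)
    δw≡eq : δ * w ≡ e * q
    δw≡eq = proj₂ (proj₂ step)
    δ<q : δ < q
    δ<q = *-cancelʳ-<-nonNeg w
      (subst (_< q * w) (sym δw≡eq)
        (<-of-diff (*-pos 0<q (+-pos 0<qq 0<qq))
          (solve 2 (λ q e → e :* q :+ q :* (q :* q :+ q :* q)
                            := q :* (q :* q :+ q :* q :+ e)) refl q e)))
    2qδ<e : (q + q) * δ < e
    2qδ<e = *-cancelʳ-<-nonNeg w
      (subst (_< e * w)
        (trans (cong ((q + q) *_) (sym δw≡eq)) (sym (*-assoc (q + q) δ w)))
        (<-of-diff (*-pos 0<e 0<e)
          (solve 2 (λ q e → (q :+ q) :* (e :* q) :+ e :* e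
                            := e :* (q :* q :+ q :* q :+ e)) refl q e)))
    above : t < (q - δ) * (q - δ)
    above = <-of-diff (+-pos (diff-pos 2qδ<e) (*-pos 0<δ 0<δ))
      (solve 3 (λ q t δ →
          t :+ (((q :* q :- t) :- (q :+ q) :* δ) :+ δ :* δ)
          := (q :- δ) :* (q :- δ)) refl q t δ)

-- The nonnegative square root; on negative arguments it takes the value 0.

√ : ℝ → ℝ
√ x = record
  { Lower           = L
  ; Upper           = U
  ; lower-inhabited = - 1ℚ , inj₁ (negative⁻¹ (- 1ℚ))
  ; upper-inhabited = inhabited
  ; lower-closed    = closed
  ; upper-closed    = λ { p<q (0<p , u) →
      <-trans 0<p p<q , upper-closed x (square-< (<⇒≤ 0<p) p<q) u }
  ; lower-open      = open-below
  ; upper-open      = λ { (0<q , u) →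
      let t , t<qq , u′      = upper-open x u
          r , r<q , 0<r , t<rr = square-open-above 0<q t<qq
      in r , r<q , 0<r , upper-closed x t<rr u′ }
  ; disjoint        = λ { (inj₁ q<0) (0<q , _) → <-asym q<0 0<q
                        ; (inj₂ l)   (_   , u) → disjoint x l u }
  ; located         = split
  }
  where
  L U : ℚ → Set
  L q = q < 0ℚ ⊎ Lower x (q * q)
  U q = 0ℚ < q × Upper x (q * q)

  inhabited : ∃ U
  inhabited with upper-inhabited x
  ... | u , ux with 0ℚ <? u
  ...   | no  u≯0 = 1ℚ , positive⁻¹ 1ℚ
                  , upper-closed x (≤-<-trans (≮⇒≥ u≯0) (positive⁻¹ 1ℚ)) ux
  ...   | yes 0<u = u + 1ℚ , +-pos 0<u (positive⁻¹ 1ℚ)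
                  , upper-closed x u<[u+1]² ux
    where
    open +-*-Solver
    u<[u+1]² : u < (u + 1ℚ) * (u + 1ℚ)
    u<[u+1]² = <-of-diff (+-pos (+-pos (*-pos 0<u 0<u) 0<u) (positive⁻¹ 1ℚ))
      (solve 1 (λ u → u :+ (u :* u :+ u :+ con 1ℚ)
                      := (u :+ con 1ℚ) :* (u :+ con 1ℚ)) refl u)

  closed : ∀ {p q} → p < q → L q → L p
  closed {p} p<q l with p <? 0ℚ | l
  ... | yes p<0 | _        = inj₁ p<0
  ... | no  p≮0 | inj₁ q<0 = contradiction (<-trans p<q q<0) p≮0
  ... | no  p≮0 | inj₂ l′  = inj₂ (lower-closed x (square-< (≮⇒≥ p≮0) p<q) l′)

  open-below : ∀ {q} → L q → ∃[ r ] q < r × L r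
  open-below {q} l with q <? 0ℚ | l
  ... | yes q<0 | _        = let r , q<r , r<0 = <-dense q<0 in
                             r , q<r , inj₁ r<0
  ... | no  q≮0 | inj₁ q<0 = contradiction q<0 q≮0
  ... | no  q≮0 | inj₂ l′  =
    let t , qq<t , lt = lower-open x l′
        r , q<r , rr<t = square-open-below (≮⇒≥ q≮0) qq<t
    in r , q<r , inj₂ (lower-closed x rr<t lt)

  split : ∀ {p q} → p < q → L p ⊎ U q
  split {p} {q} p<q with p <? 0ℚ
  ... | yes p<0 = inj₁ (inj₁ p<0)
  ... | no  p≮0 with located x (square-< (≮⇒≥ p≮0) p<q)
  ...   | inj₁ l = inj₁ (inj₂ l)
  ...   | inj₂ u = inj₂ (≤-<-trans (≮⇒≥ p≮0) p<q , u)

-- A relation rather than a function, since the floor of an arbitrary real is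
-- not computable.

IsFloor : ℝ → ℤ → Set
IsFloor y k = fromℤ k ≤ᴿ y × (∀ j → fromℤ j ≤ᴿ y → j ℤ.≤ k)

IsFloor-unique : ∀ {y k l} → IsFloor y k → IsFloor y l → k ≡ l
IsFloor-unique (k≤y , kmax) (l≤y , lmax) = ℤ.≤-antisym (lmax _ k≤y) (kmax _ l≤y)

b : ℕ → ℝ
b X = (√ (fromℕ (4 ℕ.* X ℕ.+ 1)) +ᴿ - 1ℚ) /ᴿ (+ 2 / 1)

-- ℕ division by n is the floor of the quotient.

S : ℕ → ℕ → Set
S X m = ℕ.NonZero m × ∃[ n ] ∃ λ (n≢0 : ℕ.NonZero n) →
        n ℕ.≤ X × m ≡ (X ℕ./ n) {{n≢0}}

-- P has c distinct elements; proofs of P m are not counted.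

HasCardinality : (ℕ → Set) → ℕ → Set
HasCardinality P c = ∃ λ (xs : List ℕ) →
  Unique xs × (∀ m → m ∈ xs ⇔ P m) × length xs ≡ c

{-# OPTIONS --safe #-}
-- Let k be the integer with k(k+1) ≤ X < (k+1)(k+2). Since (2k+1)² = 4k(k+1)+1, ⌊b⌋ = k.
-- The quotients X/1 > … > X/k > X/(k+1) strictly decrease because X/n > X/(n+1) as
-- soon as n(n+1) ≤ X. Below q = X/(k+1) no value is skipped: q ≤ k+1, and every
-- m ≥ 1 with m(m+1) ≤ X, in particular every 1 ≤ m ≤ k, is the quotient X/n at n = X/m.
-- So S(X) is the disjoint union of {X/1,…,X/k} and {1,…,q}.
module Submission where

open import Defs
open import Data.Nat.Base using (ℕ; NonZero; _+_; _/_)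
open import Data.Integer.Base using (+_)
open import Data.Rational.Base using (1ℚ)
open import Data.Product.Base using (Σ; ∃₂; _×_)

open import Data.Integer.Base as ℤ using (ℤ)
import Data.Integer.Properties as ℤ
open import Data.List.Base using (List; _++_; applyUpTo)
open import Data.List.Membership.Propositional using (_∈_)
open import Data.List.Membership.Propositional.Properties
  using (∈-++⁺ˡ; ∈-++⁺ʳ; ∈-++⁻; ∈-applyUpTo⁺; ∈-applyUpTo⁻)
open import Data.List.Properties using (length-++; length-applyUpTo)
open import Data.List.Relation.Unary.Unique.Propositional using (Unique)
import Data.List.Relation.Unary.Unique.Propositional.Properties as Unique
open import Data.Nat.Base
  using (zero; suc; _*_; _≤_; _<_; z≤n; s≤s; s≤s⁻¹; z<s; >-nonZero)
import Data.Nat.Coprimality as Coprimality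
open import Data.Nat.DivMod
open import Data.Nat.Properties
open import Data.Nat.Tactic.RingSolver using (solve-∀)
open import Data.Product.Base using (∃-syntax; _,_)
open import Data.Rational.Base as ℚ using (ℚ; 0ℚ)
import Data.Rational.Properties as ℚ
open import Data.Rational.Solver using (module +-*-Solver)
open import Data.Sum.Base using (inj₁; inj₂)
open import Function.Bundles using (mk⇔)
open import Relation.Binary.PropositionalEquality
open import Relation.Nullary using (yes; no; contradiction)

open ℝ

-- Integers inside the rationals.

-- `i ℚ./ 1` is normalised through a gcd and is stuck on a variable `i`; this already reduced form
-- computes, so the lemmas below rewrite to it.
integer : ℤ → ℚ
integer i = ℚ.mkℚ i 0 (Coprimality.sym (Coprimality.1-coprimeTo ℤ.∣ i ∣))

i/1≡integer : ∀ i → i ℚ./ 1 ≡ integer i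
i/1≡integer i = ℚ.↥p/↧p≡p (integer i)

/1-homo-+ : ∀ i j → i ℚ./ 1 ℚ.+ j ℚ./ 1 ≡ (i ℤ.+ j) ℚ./ 1
/1-homo-+ i j rewrite i/1≡integer i | i/1≡integer j =
  cong (ℚ._/ 1) (cong₂ ℤ._+_ (ℤ.*-identityʳ i) (ℤ.*-identityʳ j))

/1-homo-* : ∀ i j → (i ℚ./ 1) ℚ.* (j ℚ./ 1) ≡ (i ℤ.* j) ℚ./ 1
/1-homo-* i j rewrite i/1≡integer i | i/1≡integer j = refl

/1-mono-< : ∀ {i j} → i ℤ.< j → i ℚ./ 1 ℚ.< j ℚ./ 1
/1-mono-< {i} {j} i<j rewrite i/1≡integer i | i/1≡integer j =
  ℚ.*<* (subst₂ ℤ._<_ (sym (ℤ.*-identityʳ i)) (sym (ℤ.*-identityʳ j)) i<j)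

/1-mono-≤ : ∀ {i j} → i ℤ.≤ j → i ℚ./ 1 ℚ.≤ j ℚ./ 1
/1-mono-≤ {i} {j} i≤j rewrite i/1≡integer i | i/1≡integer j =
  ℚ.*≤* (subst₂ ℤ._≤_ (sym (ℤ.*-identityʳ i)) (sym (ℤ.*-identityʳ j)) i≤j)

p+r-r≡p : ∀ p r → (p ℚ.+ r) ℚ.- r ≡ p
p+r-r≡p = solve 2 (λ p r → (p :+ r) :- r := p) refl
  where open +-*-Solver

square-mono-< : ∀ {p r} → 0ℚ ℚ.≤ p → p ℚ.< r → p ℚ.* p ℚ.< r ℚ.* r
square-mono-< {p} {r} 0≤p p<r = ℚ.≤-<-trans
  (ℚ.*-monoˡ-≤-nonNeg p {{ℚ.nonNegative 0≤p}} (ℚ.<⇒≤ p<r))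
  (ℚ.*-monoˡ-<-pos r {{ℚ.positive (ℚ.≤-<-trans 0≤p p<r)}} p<r)

-- Floors of Dedekind reals.

-- The upper cut is open, so it contains some `r < k + 1`. An integer `j > k` with `j ≤ y` would put
-- this same `r` into the lower cut.
isFloor : ∀ {y k} → fromℤ k ≤ᴿ y → Upper y (ℤ.suc k ℚ./ 1) → IsFloor y k
isFloor {y} {k} k≤y y<k+1 = k≤y , maximal
  where
  maximal : ∀ j → fromℤ j ≤ᴿ y → j ℤ.≤ k
  maximal j j≤y with j ℤ.≤? k
  ... | yes j≤k = j≤k
  ... | no  j≰k =
    let r , r<k+1 , y<r = upper-open y y<k+1
        k+1≤j           = /1-mono-≤ (ℤ.i<j⇒suc[i]≤j (ℤ.≰⇒> j≰k))
    in contradiction y<r (disjoint y (j≤y (ℚ.<-≤-trans r<k+1 k+1≤j)))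

isFloor-+1 : ∀ {y k} → IsFloor y k → IsFloor (y +ᴿ 1ℚ) (ℤ.suc k)
isFloor-+1 {y} {k} (k≤y , maximal) = lower , maximal′
  where
  suc/1 : ∀ i → ℤ.suc i ℚ./ 1 ≡ i ℚ./ 1 ℚ.+ 1ℚ
  suc/1 i = trans (sym (/1-homo-+ (+ 1) i)) (ℚ.+-comm 1ℚ (i ℚ./ 1))

  lower : fromℤ (ℤ.suc k) ≤ᴿ (y +ᴿ 1ℚ)
  lower {p} p<k+1 = k≤y (subst (p ℚ.- 1ℚ ℚ.<_)
    (trans (cong (ℚ._- 1ℚ) (suc/1 k)) (p+r-r≡p (k ℚ./ 1) 1ℚ))
    (ℚ.+-monoˡ-< (ℚ.- 1ℚ) p<k+1))

  maximal′ : ∀ j → fromℤ j ≤ᴿ (y +ᴿ 1ℚ) → j ℤ.≤ ℤ.suc k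
  -- Maximality of `k` is applied to `j - 1`, which is at most `y`.
  maximal′ j j≤y+1 = subst (ℤ._≤ ℤ.suc k) (ℤ.suc-pred j)
    (ℤ.suc-mono (maximal (ℤ.pred j) λ {p} p<j-1 →
      subst (Lower y) (p+r-r≡p p 1ℚ) (j≤y+1
        (subst (p ℚ.+ 1ℚ ℚ.<_)
          (trans (sym (suc/1 (ℤ.pred j))) (cong (ℚ._/ 1) (ℤ.suc-pred j)))
          (ℚ.+-monoˡ-< 1ℚ p<j-1)))))

-- The floor of `b X`.

[2n+1]² : ∀ n → (n * 2 + 1) * (n * 2 + 1) ≡ 4 * (n * suc n) + 1
[2n+1]² = solve-∀

2n+1/1 : ∀ n → (+ n ℚ./ 1) ℚ.* (+ 2 ℚ./ 1) ℚ.+ 1ℚ ≡ + (n * 2 + 1) ℚ./ 1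
2n+1/1 n = begin
  (+ n ℚ./ 1) ℚ.* (+ 2 ℚ./ 1) ℚ.+ 1ℚ   ≡⟨ cong (ℚ._+ 1ℚ) (/1-homo-* (+ n) (+ 2)) ⟩
  (+ n ℤ.* + 2) ℚ./ 1 ℚ.+ 1ℚ           ≡⟨ /1-homo-+ (+ n ℤ.* + 2) (+ 1) ⟩
  (+ n ℤ.* + 2 ℤ.+ + 1) ℚ./ 1          ≡⟨ cong (λ i → (i ℤ.+ + 1) ℚ./ 1) (ℤ.pos-* n 2) ⟨
  + (n * 2 + 1) ℚ./ 1                  ∎
  where open ≡-Reasoning

square-/1 : ∀ n → (+ n ℚ./ 1) ℚ.* (+ n ℚ./ 1) ≡ + (n * n) ℚ./ 1
square-/1 n = trans (/1-homo-* (+ n) (+ n)) (cong (ℚ._/ 1) (sym (ℤ.pos-* n n)))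

-- By unfolding, `p` is in the lower cut of `b X` when `2p + 1` is in that of the root: it is
-- negative, or its square is below `4X + 1`. In the second case the bound passes through
-- `(2k + 1)²`.
b-lower : ∀ X k → k * suc k ≤ X → fromℕ k ≤ᴿ b X
b-lower X k k[k+1]≤X {p} p<k with p ℚ.* (+ 2 ℚ./ 1) ℚ.+ 1ℚ ℚ.<? 0ℚ
... | yes 2p+1<0 = inj₁ 2p+1<0
... | no  2p+1≮0 = inj₂ (ℚ.<-≤-trans
  (square-mono-< (ℚ.≮⇒≥ 2p+1≮0) 2p+1<2k+1)
  (subst (ℚ._≤ + (4 * X + 1) ℚ./ 1)
    (sym (trans (square-/1 (k * 2 + 1)) (cong (λ n → + n ℚ./ 1) ([2n+1]² k))))
    (/1-mono-≤ (ℤ.+≤+ (+-monoˡ-≤ 1 (*-monoʳ-≤ 4 k[k+1]≤X))))))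
  where
  2p+1<2k+1 : p ℚ.* (+ 2 ℚ./ 1) ℚ.+ 1ℚ ℚ.< + (k * 2 + 1) ℚ./ 1
  2p+1<2k+1 = subst (p ℚ.* (+ 2 ℚ./ 1) ℚ.+ 1ℚ ℚ.<_) (2n+1/1 k)
    (ℚ.+-monoˡ-< 1ℚ (ℚ.*-monoˡ-<-pos (+ 2 ℚ./ 1) p<k))

b-upper : ∀ X n → X < n * suc n → Upper (b X) (+ n ℚ./ 1)
b-upper X n X<n[n+1] = subst (Upper (√ (fromℕ (4 * X + 1)))) (sym (2n+1/1 n))
  ( /1-mono-< (ℤ.+<+ (m≤n+m 1 (n * 2)))
  , subst (+ (4 * X + 1) ℚ./ 1 ℚ.<_)
      (sym (trans (square-/1 (n * 2 + 1)) (cong (λ m → + m ℚ./ 1) ([2n+1]² n))))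
      (/1-mono-< (ℤ.+<+ (+-monoˡ-< 1 (*-monoʳ-< 4 X<n[n+1])))))

b-isFloor : ∀ X k → k * suc k ≤ X → X < suc k * suc (suc k) → IsFloor (b X) (+ k)
b-isFloor X k lower upper = isFloor {b X} (b-lower X k lower) (b-upper X (suc k) upper)

pronic-bracket : ∀ X → ∃[ k ] k * suc k ≤ X × X < suc k * suc (suc k)
pronic-bracket zero    = 0 , z≤n , z<s
pronic-bracket (suc X) with pronic-bracket X
... | k , lower , upper with suc X <? suc k * suc (suc k)
...   | yes upper′ = k , m≤n⇒m≤1+n lower , upper′
...   | no  X+1≮   = suc k , ≮⇒≥ X+1≮ ,
  -- The old upper bound, read as `suc X ≤ suc k * suc (suc k)`, lies strictly below the next pronic
  -- number.
  ≤-<-trans upper (*-mono-< (n<1+n (suc k)) (n<1+n (suc (suc k))))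

-- Quotients `X / n`.

m*n≤o⇒m≤o/n : ∀ m n o .{{_ : NonZero n}} → m * n ≤ o → m ≤ o / n
m*n≤o⇒m≤o/n m n o mn≤o = subst (_≤ o / n) (m*n/n≡m m n) (/-monoˡ-≤ n mn≤o)

m<[1+m/n]*n : ∀ m n .{{_ : NonZero n}} → m < suc (m / n) * n
m<[1+m/n]*n m n = subst (_< suc (m / n) * n) (sym (m≡m%n+[m/n]*n m n))
  (+-monoˡ-< (m / n * n) (m%n<n m n))

-- With `q = X / (n + 1)`, the hypothesis gives `n ≤ q`, so `(q + 1) n = q n + n ≤ q (n + 1) ≤ X`.
/-strict-antitone : ∀ X n .{{_ : NonZero n}} → n * suc n ≤ X → X / suc n < X / n
/-strict-antitone X n n[n+1]≤X = m*n≤o⇒m≤o/n (suc q) n X (begin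
  suc q * n   ≡⟨ +-comm n (q * n) ⟩
  q * n + n   ≤⟨ +-monoʳ-≤ (q * n) (m*n≤o⇒m≤o/n n (suc n) X n[n+1]≤X) ⟩
  q * n + q   ≡⟨ trans (+-comm (q * n) q) (sym (*-suc q n)) ⟩
  q * suc n   ≤⟨ m/n*n≤m X (suc n) ⟩
  X           ∎)
  where
  open ≤-Reasoning
  q = X / suc n

-- Put `n = X / m`. From `n m ≤ X` comes `m ≤ X / n`. The hypothesis forces `m < n`, so
-- `X < m + n m ≤ (m + 1) n`, which gives `X / n ≤ m`.
/-involutive : ∀ X m .{{_ : NonZero m}} .{{_ : NonZero (X / m)}} →
               m * suc m ≤ X → m ≡ X / (X / m)
/-involutive X m m[m+1]≤X = ≤-antisym
  (m*n≤o⇒m≤o/n m n X (subst (_≤ X) (*-comm n m) (m/n*n≤m X m)))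
  (s≤s⁻¹ (m<n*o⇒m/o<n (begin-strict
    X           <⟨ m<[1+m/n]*n X m ⟩
    m + n * m   ≤⟨ +-monoˡ-≤ (n * m) (≤-trans (n≤1+n m) m<n) ⟩
    n + n * m   ≡⟨ cong (λ z → n + z) (*-comm n m) ⟩
    suc m * n   ∎)))
  where
  open ≤-Reasoning
  n = X / m
  m<n : m < n
  m<n = m*n≤o⇒m≤o/n (suc m) m X (subst (_≤ X) (*-comm m (suc m)) m[m+1]≤X)

-- Counting `S X`.

module _ (X k : ℕ) (lower : k * suc k ≤ X) (upper : X < suc k * suc (suc k)) where

  private
    q : ℕ
    q = X / suc k

    large small values : List ℕ
    large  = applyUpTo (λ i → X / suc i) k
    small  = applyUpTo suc q
    values = large ++ small

  -- This leaves `k + 1` as the only possible element of `small` beyond the reach of `/-involutive`.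
  q≤k+1 : q ≤ suc k
  q≤k+1 = s≤s⁻¹ (m<n*o⇒m/o<n (subst (X <_) (*-comm (suc k) (suc (suc k))) upper))

  pronic≤X : ∀ {n} → n ≤ k → n * suc n ≤ X
  pronic≤X n≤k = ≤-trans (*-mono-≤ n≤k (s≤s n≤k)) lower

  k≤X : k ≤ X
  k≤X = ≤-trans (m≤m*n k (suc k)) lower

  -- Only the step from `suc i` to `suc (suc i)` has to be strict; the rest is weak monotonicity.
  -- The case `j = k` compares `large` with `q`.
  quotient-anti-< : ∀ {i j} → i < j → j ≤ k → X / suc j < X / suc i
  quotient-anti-< {i} {j} i<j j≤k = ≤-<-trans (/-monoʳ-≤ X (s≤s i<j))
    (/-strict-antitone X (suc i) (pronic≤X (≤-trans i<j j≤k)))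

  values-unique : Unique values
  values-unique = Unique.++⁺
    (Unique.applyUpTo⁺₁ _ k λ i<j j<k eq → <⇒≢ (quotient-anti-< i<j (<⇒≤ j<k)) (sym eq))
    (Unique.applyUpTo⁺₁ suc q λ i<j _ eq → <⇒≢ i<j (suc-injective eq))
    λ { (v∈large , v∈small) → disjoint-large-small v∈large v∈small }
    where
    disjoint-large-small : ∀ {v} → v ∈ large → v ∈ small → _
    disjoint-large-small v∈large v∈small
      with ∈-applyUpTo⁻ _ v∈large | ∈-applyUpTo⁻ suc v∈small
    ... | i , i<k , refl | j , j<q , eq =
      -- Elements of `large` exceed `q`, those of `small` do not.
      <⇒≱ (quotient-anti-< i<k ≤-refl) (subst (_≤ q) (sym eq) j<q)

  S⇒values : ∀ {m} → S X m → m ∈ values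
  S⇒values (m≢0 , suc n , _ , _ , refl) with n <? k
  ... | yes n<k = ∈-++⁺ˡ (∈-applyUpTo⁺ _ n<k)
  -- The divisor is at least `k + 1`, so the value is at most `q`; `m≢0` is needed because `small`
  -- starts at 1.
  ... | no  n≮k = ∈-++⁺ʳ large (small⁺ m≢0 (/-monoʳ-≤ X (s≤s (≮⇒≥ n≮k))))
    where
    small⁺ : ∀ {m} → NonZero m → m ≤ q → m ∈ small
    small⁺ {suc m} _ m<q = ∈-applyUpTo⁺ suc m<q

  large⇒S : ∀ {m} → m ∈ large → S X m
  large⇒S m∈large with ∈-applyUpTo⁻ _ m∈large
  ... | i , i<k , refl =
    >-nonZero (≤-<-trans z≤n (quotient-anti-< i<k ≤-refl)) ,
    suc i , _ , ≤-trans i<k k≤X , refl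

  small⇒S : ∀ {m} → m ∈ small → S X m
  small⇒S m∈small with ∈-applyUpTo⁻ suc m∈small
  ... | i , i<q , refl with i <? k
  ...   | yes i<k =
    -- The value `m = suc i` is at most `k` here, and it is attained at `n = X / m`.
    _ , X / suc i , X/m≢0 , m/n≤m X (suc i) ,
    /-involutive X (suc i) {{_}} {{X/m≢0}} (pronic≤X i<k)
    where
    X/m≢0 : NonZero (X / suc i)
    X/m≢0 = >-nonZero (≤-<-trans z≤n (/-strict-antitone X (suc i) (pronic≤X i<k)))
  -- Now `suc i ≤ q ≤ suc k ≤ suc i`, so the value is `q` itself, attained at `suc k`.
  ...   | no  i≮k =
    _ , suc k , _ , k+1≤X , ≤-antisym i<q (≤-trans q≤k+1 (s≤s (≮⇒≥ i≮k)))
    where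
    k+1≤X : suc k ≤ X
    -- `q` is positive, as `i < q`, so the divisor `suc k` cannot exceed `X`.
    k+1≤X = m/n≢0⇒n≤m λ q≡0 → <⇒≢ (≤-<-trans z≤n i<q) (sym q≡0)

  S-cardinality : HasCardinality (S X) (k + q)
  S-cardinality = values , values-unique , (λ m → mk⇔ values⇒S S⇒values) ,
    trans (length-++ large) (cong₂ _+_ (length-applyUpTo _ k) (length-applyUpTo suc q))
    where
    values⇒S : ∀ {m} → m ∈ values → S X m
    values⇒S m∈values with ∈-++⁻ large m∈values
    ... | inj₁ m∈large = large⇒S m∈large
    ... | inj₂ m∈small = small⇒S m∈small

theorem1p1 : (X : ℕ) → .{{NonZero X}} →
    ∃₂ λ (⌊b⌋ ⌊b+1⌋ : ℕ) →
    IsFloor (b X) (+ ⌊b⌋) ×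
    IsFloor (b X +ᴿ 1ℚ) (+ ⌊b+1⌋) ×
    Σ (NonZero ⌊b+1⌋) λ nz →
    HasCardinality (S X) (⌊b⌋ + (X / ⌊b+1⌋) {{nz}})
theorem1p1 X with pronic-bracket X
... | k , lower , upper =
  k , suc k , floor-b , isFloor-+1 {b X} floor-b , _ , S-cardinality X k lower upper
  where
  floor-b : IsFloor (b X) (+ k)
  floor-b = b-isFloor X k lower upper
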